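{- For every integer $s\geq 2$, \[\gamma(S(K_s^{(2)}))\geq \left(1-\frac{1}{s-1}\right)\left(1-\frac{2}{s-1}\right),\] where $S(K_s^{(2)})$ is the suspension of the complete 2-graph on $s$ vertices and $\gamma$ denotes codegree density.
   Context: A 3-graph is a pair $G=(V,E)$ with $V$ a finite vertex set and $E$ a set of 3-element subsets of $V$ (the 3-edges). A 3-graph contains another 3-graph $F$ as a subgraph if it has a (not necessarily induced) subgraph isomorphic to $F$. A 2-graph is an ordinary graph; $K_s^{(2)}$ is the complete 2-graph on $s$ vertices. For a 2-graph $H$, its suspension $S(H)$ is the 3-graph with vertex set $V(H)\sqcup\{x_\star\}$ and 3-edges $\{x_\star vv': vv'\in E(H)\}$. For a family $\mathcal{F}$ of non-empty 3-graphs (i.e. each having at least one 3-edge), the codegree threshold $\mathrm{coex}(n,\mathcal{F})$ is the largest integer $d$ such that there exists an $n$-vertex 3-graph in which every pair of distinct vertices is contained in at least $d$ 3-edges and which contains no member of $\mathcal{F}$ as a subgraph. The codegree density of $\mathcal{F}$ is $\gamma(\mathcal{F})=\lim_{n\to\infty}\frac{\mathrm{coex}(n,\mathcal{F})}{n-2}$; this limit is known to exist for every such $\mathcal{F}$ (Mubayi and Zhao). For a single 3-graph $F$, write $\gamma(F)=\gamma(\{F\})$. -}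

module Defs where

open import Data.Empty using (⊥)
open import Data.Fin.Base using (Fin)
open import Data.Fin.Properties using (any?) renaming (_≟_ to _≟ᶠ_)
open import Data.Fin.Subset using (Subset; inside; outside; ⁅_⁆; _∪_; ∣_∣)
open import Data.Fin.Subset.Properties using (_∈?_)
open import Data.Integer.Base using (+_)
open import Data.Nat.Base as ℕ using (ℕ; suc)
import Data.Nat.Properties as ℕ
open import Data.Product.Base using (Σ; ∃-syntax; _×_; _,_)
open import Data.Rational.Base using (ℚ; 0ℚ; _/_; _+_; _-_; _≤_; _<_) renaming (∣_∣ to ∣_∣ℚ)
import Data.Rational.Properties as ℚ
open import Data.Vec.Base using (_∷_; tabulate)
open import Function.Base using (_∘_)
open import Function.Definitions using (Injective)
open import Level using (0ℓ)
open import Relation.Binary.PropositionalEquality.Core using (_≡_; _≢_; sym; cong; subst)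
open import Relation.Nullary using (¬_; does; no)
open import Relation.Nullary.Decidable using (_×-dec_)
open import Relation.Unary using (Pred; Decidable; ｛_｝)

-- Subsets of Fin n are Boolean vectors, so this is { x ∣ P x }.
subset : ∀ {n} {P : Pred (Fin n) 0ℓ} → Decidable P → Subset n
subset P? = tabulate (does ∘ P?)

image : ∀ {m n} → (Fin m → Fin n) → Subset m → Subset n
image f e = subset (λ y → any? (λ x → (x ∈? e) ×-dec (f x ≟ᶠ y)))

record Hypergraph (r n : ℕ) : Set₁ where
  field
    Edge    : Pred (Subset n) 0ℓ
    edge?   : Decidable Edge
    uniform : ∀ {e} → Edge e → ∣ e ∣ ≡ r

open Hypergraph public

2-Graph 3-Graph : Set₁
2-Graph = Σ ℕ (Hypergraph 2)
3-Graph = Σ ℕ (Hypergraph 3)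

complete : ℕ → 2-Graph
complete s = s , record
  { Edge    = λ e → ∣ e ∣ ≡ 2
  ; edge?   = λ e → ∣ e ∣ ℕ.≟ 2
  ; uniform = λ eq → eq
  }

-- The apex x⋆ is Fin.zero and a vertex v of H becomes Fin.suc v; thus the
-- subset inside ∷ e is {x⋆} together with the copy of e.
suspension : 2-Graph → 3-Graph
suspension (m , H) = suc m , record
  { Edge = E ; edge? = E? ; uniform = λ {e} → E-uniform e }
  where
  E : Pred (Subset (suc m)) 0ℓ
  E (inside  ∷ e) = Edge H e
  E (outside ∷ e) = ⊥

  E? : Decidable E
  E? (inside  ∷ e) = edge? H e
  E? (outside ∷ e) = no λ ()

  E-uniform : ∀ e → E e → ∣ e ∣ ≡ 3
  E-uniform (inside  ∷ e) Ee = cong suc (uniform H Ee)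
  E-uniform (outside ∷ e) ()

Contains : 3-Graph → 3-Graph → Set
Contains (n , G) (m , F) =
  ∃[ f ] Injective _≡_ _≡_ f × (∀ e → Edge F e → Edge G (image {m} {n} f e))

-- For u ≢ v, w ↦ {u , v , w} is a bijection from the w counted here to the
-- 3-edges containing u and v: w ∈ {u , v} would give a set of size 2.
codegree : ∀ {n} → Hypergraph 3 n → Fin n → Fin n → ℕ
codegree G u v = ∣ subset (λ w → edge? G (⁅ u ⁆ ∪ ⁅ v ⁆ ∪ ⁅ w ⁆)) ∣

Family : Set₂
Family = Pred 3-Graph (Level.suc 0ℓ)

Attainable : Family → ℕ → ℕ → Set₁
Attainable 𝓕 n d = Σ (Hypergraph 3 n) λ G →
  (∀ u v → u ≢ v → d ℕ.≤ codegree G u v) ×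
  (∀ F → 𝓕 F → ¬ Contains (n , G) F)

IsCoex : Family → ℕ → ℕ → Set₁
IsCoex 𝓕 n d = Attainable 𝓕 n d × (∀ d′ → Attainable 𝓕 n d′ → d′ ℕ.≤ d)

-- The double negation makes convergence classical, so that bounded monotone
-- sequences converge without an explicit modulus.
Eventually : Pred ℕ 0ℓ → Set
Eventually P = ¬ ¬ (∃[ N ] ∀ n → N ℕ.≤ n → P n)

Cauchy : (ℕ → ℚ) → Set
Cauchy a = ∀ ε → 0ℚ < ε → Eventually λ m → ∀ n → m ℕ.≤ n → ∣ a m - a n ∣ℚ ≤ ε

record ℝ : Set where
  field
    seq    : ℕ → ℚ
    cauchy : Cauchy seq

open ℝ public

fromℚ : ℚ → ℝ
fromℚ q = record
  { seq    = λ _ → q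
  ; cauchy = λ ε 0<ε k → k (0 , λ _ _ _ _ →
      subst (λ p → ∣ p ∣ℚ ≤ ε) (sym (ℚ.+-inverseʳ q)) (ℚ.<⇒≤ 0<ε))
  }

infix 4 _≤ℝ_

_≤ℝ_ : ℝ → ℝ → Set
x ≤ℝ y = ∀ ε → 0ℚ < ε → Eventually λ n → seq x n ≤ seq y n + ε

ConvergesTo : (ℕ → ℚ) → ℝ → Set
ConvergesTo a x = ∀ ε → 0ℚ < ε →
  Eventually λ n → fromℚ (a n - ε) ≤ℝ x × x ≤ℝ fromℚ (a n + ε)

-- For n < 2 there is no pair of distinct vertices, hence no largest d. The
-- sequence is coex n / (n - 2) for n ≥ 3, reindexed by n = 3 + k.
IsCodegreeDensityOf : Family → ℝ → Set₁
IsCodegreeDensityOf 𝓕 γ = Σ (ℕ → ℕ) λ coex →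
  (∀ n → 2 ℕ.≤ n → IsCoex 𝓕 n (coex n)) ×
  ConvergesTo (λ k → + coex (3 ℕ.+ k) / suc k) γ

IsCodegreeDensity : 3-Graph → ℝ → Set₁
IsCodegreeDensity F = IsCodegreeDensityOf ｛ F ｝

{-# OPTIONS --safe #-}
-- Let t = s − 1. Give every vertex x a colouring c x of the other vertices with
-- t colours, and let xyz be a 3-edge when c x y ≢ c x z, c y x ≢ c y z and
-- c z x ≢ c z y. Every link is then t-colourable, so S(K_s) does not occur.
-- The vertices are pairs (x , a) of an index x and a shift a ∈ ℤ/t, and
-- (h , _) gives (x , a) the colour M h x + a for a square matrix M over ℤ/t.
-- For vertices u ≢ v and each h that distinguishes u from v, at least t − 2
-- shifts b make (h , b) complete u, v to a 3-edge; so it is enough that any two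
-- columns of M, with any shifts, agree in little more than 1 / t of the rows.
-- Such an M comes from hashing: keys in Q^(2^k) are contracted by a binary tree
-- with one arbitrary map Q × Q → Q per level, then mapped to ℤ/t by an arbitrary
-- map. Two keys collide in the tree with probability at most k / ∣Q∣, and there
-- are more keys than hash functions once 2^k exceeds about ∣Q∣² k, so M can be
-- taken square. Since the density is a limit, infinitely many orders suffice.
module Submission where

import Algebra.Properties.Semiring.Sum
open import Data.Bool.Base using (true; false; if_then_else_)
open import Data.Fin.Base using (Fin; zero; suc; toℕ; _↑ˡ_; _↑ʳ_; remQuot; combine; finToFun; inject≤)
import Data.Fin.Properties as F
open import Data.Fin.Subset using (Subset; inside; outside; _∈_; _∉_; ⁅_⁆; _∪_; ∣_∣)
open import Data.Fin.Subset.Properties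
  using (_∈?_; x∈⁅x⁆; x∈⁅y⁆⇒x≡y; ∣⁅x⁆∣≡1; x∈p∪q⁺; x∈p∪q⁻; ∪-identityˡ)
open import Data.Nat.Base as ℕ using (ℕ; zero; suc; _∸_; z≤n; s≤s; NonZero; >-nonZero)
import Data.Nat.Properties as ℕ
open import Data.Nat.Properties using (m<n⇒0<n∸m)
open import Data.Nat.Tactic.RingSolver using (solve-∀)
open import Data.Product.Base using (∃-syntax; ∃₂; _×_; _,_; proj₁; proj₂; uncurry)
open import Data.Sum.Base using (_⊎_; inj₁; inj₂)
open import Data.Vec.Base using (_∷_; here; there)
open import Data.Vec.Properties using (lookup⇒[]=; lookup∘tabulate)
open import Function.Base using (_∘_; id)
open import Function.Definitions using (Injective)
open import Level using (Level)
open import Relation.Binary.PropositionalEquality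
open import Relation.Nullary using (¬_; Dec; does; yes; no; contradiction)
open import Relation.Nullary.Decidable using (_×-dec_; _→-dec_; ¬?; dec-true)
open import Relation.Unary using (Pred; Decidable; _⊆_; ｛_｝)
open import Defs

private variable
  a b k m n r t w : ℕ

module Construction where
  open import Data.Nat.Base using (_+_; _*_; _^_; _≤_)
  open import Data.Nat.DivMod
    using (_/_; _%_; _mod_; m≡m%n+[m/n]*n; m%n<n; m/n*n≤m; m<n⇒m%n≡m; [m+n]%n≡m%n; %-distribˡ-+)
  open Algebra.Properties.Semiring.Sum ℕ.+-*-semiring
    using (sum; sum-cong-≗; ∑-distrib-+; ∑-comm; *-distribˡ-sum)

  -- Finite sums and counting

  sum-mono-≤ : ∀ {f g : Fin n → ℕ} → (∀ i → f i ≤ g i) → sum f ≤ sum g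
  sum-mono-≤ {zero}  f≤g = z≤n
  sum-mono-≤ {suc n} f≤g = ℕ.+-mono-≤ (f≤g zero) (sum-mono-≤ (f≤g ∘ suc))

  sum-const : ∀ n c → sum {n} (λ _ → c) ≡ n * c
  sum-const zero    c = refl
  sum-const (suc n) c = cong (c +_) (sum-const n c)

  sum-++ : ∀ m (f : Fin (m + n) → ℕ) →
           sum f ≡ sum (λ i → f (i ↑ˡ n)) + sum (λ j → f (m ↑ʳ j))
  sum-++ zero    f = refl
  sum-++ (suc m) f = trans (cong (f zero +_) (sum-++ m (f ∘ suc))) (sym (ℕ.+-assoc (f zero) _ _))

  sum-combine : ∀ m (f : Fin (m * n) → ℕ) →
                sum f ≡ sum {m} λ i → sum {n} λ j → f (combine i j)
  sum-combine         zero    f = refl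
  sum-combine {n = n} (suc m) f =
    trans (sum-++ n f) (cong (sum (λ j → f (j ↑ˡ (m * n))) +_) (sum-combine m (f ∘ (n ↑ʳ_))))

  -- Pairs (map and hash function, index and shift) are coded as single elements of a product-sized
  -- `Fin`; this turns counts over the code into iterated sums.
  sum-remQuot : ∀ m (f : Fin m → Fin n → ℕ) →
                sum (λ i → uncurry f (remQuot {m} n i)) ≡ sum λ i → sum (f i)
  sum-remQuot {n} m f = trans (sum-combine m _)
    (sum-cong-≗ λ i → sum-cong-≗ λ j → cong (uncurry f) (F.remQuot-combine i j))

  χ : ∀ {p} {P : Set p} → Dec P → ℕ
  χ P? = if does P? then 1 else 0

  χ≤1 : ∀ {p} {P : Set p} (P? : Dec P) → χ P? ≤ 1
  χ≤1 (yes _) = s≤s z≤n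
  χ≤1 (no  _) = z≤n

  χ-yes : ∀ {p} {P : Set p} (P? : Dec P) → P → χ P? ≡ 1
  χ-yes (yes _) p = refl
  χ-yes (no ¬p) p = contradiction p ¬p

  χ-no : ∀ {p} {P : Set p} (P? : Dec P) → ¬ P → χ P? ≡ 0
  χ-no (yes p) ¬p = contradiction p ¬p
  χ-no (no  _) ¬p = refl

  χ-mono : ∀ {p q} {P : Set p} {Q : Set q} (P? : Dec P) (Q? : Dec Q) → (P → Q) → χ P? ≤ χ Q?
  χ-mono (no  _) Q? P→Q = z≤n
  χ-mono (yes p) Q? P→Q = ℕ.≤-reflexive (sym (χ-yes Q? (P→Q p)))

  count : ∀ {p} {P : Pred (Fin n) p} → Decidable P → ℕ
  count P? = sum (χ ∘ P?)

  count-none : ∀ {p} {P : Pred (Fin n) p} (P? : Decidable P) → (∀ i → ¬ P i) → count P? ≡ 0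
  count-none {n} P? ¬P = trans (sum-cong-≗ λ i → χ-no (P? i) (¬P i)) (trans (sum-const n 0) (ℕ.*-zeroʳ n))

  count-⊆ : ∀ {p q} {P : Pred (Fin n) p} {Q : Pred (Fin n) q}
            (P? : Decidable P) (Q? : Decidable Q) → P ⊆ Q → count P? ≤ count Q?
  count-⊆ P? Q? P⊆Q = sum-mono-≤ λ i → χ-mono (P? i) (Q? i) P⊆Q

  count-unique : ∀ {p} {P : Pred (Fin n) p} (P? : Decidable P) →
                 (∀ {i j} → P i → P j → i ≡ j) → count P? ≤ 1
  count-unique {zero}  P? unique = z≤n
  count-unique {suc n} P? unique with P? zero
  ... | yes p = s≤s (ℕ.≤-reflexive
    (count-none (P? ∘ suc) λ i q → contradiction (unique p q) λ ()))
  ... | no  _ = count-unique (P? ∘ suc) λ p q → F.suc-injective (unique p q)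

  ∣subset∣ : ∀ {n} {P : Pred (Fin n) _} (P? : Decidable P) → ∣ subset P? ∣ ≡ count P?
  ∣subset∣ {zero}  P? = refl
  ∣subset∣ {suc n} P? with does (P? zero)
  ... | true  = cong suc (∣subset∣ (P? ∘ suc))
  ... | false = ∣subset∣ (P? ∘ suc)

  -- Collisions under random maps, and tree hashing

  module _ {p : Level} {N : ℕ} {B : Fin w → Pred (Fin N) p} (B? : ∀ i → Decidable (B i)) where

    -- After exchanging the sums, each `g` contributes at most one `i`.
    count-fibrewise-unique : (∀ {g i j} → B i g → B j g → i ≡ j) →
                             count (λ f → uncurry B? (remQuot {w} N f)) ≤ N
    count-fibrewise-unique unique = begin
      count (λ f → uncurry B? (remQuot {w} N f))  ≡⟨ sum-remQuot w (λ i g → χ (B? i g)) ⟩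
      sum (λ i → sum λ g → χ (B? i g))            ≡⟨ ∑-comm (λ i g → χ (B? i g)) ⟩
      sum (λ g → count λ i → B? i g)              ≤⟨ sum-mono-≤ (λ g → count-unique (λ i → B? i g) unique) ⟩
      sum {N} (λ _ → 1)                           ≡⟨ sum-const N 1 ⟩
      N * 1                                       ≡⟨ ℕ.*-identityʳ N ⟩
      N                                           ∎
      where open ℕ.≤-Reasoning

  module _ {w t : ℕ} {σ τ : Fin w → Fin t}
           (σ-inj : Injective _≡_ _≡_ σ) (τ-inj : Injective _≡_ _≡_ τ) where

    collide? : (y y′ : Fin n) → Decidable λ (f : Fin (w ^ n)) → σ (finToFun f y) ≡ τ (finToFun f y′)
    collide? y y′ f = σ (finToFun f y) F.≟ τ (finToFun f y′)

    -- For a uniformly random map `Fin n → Fin w`, the collision has probability at most 1 / w. If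
    -- one of the points is `zero`, fix all other values: injectivity leaves at most one choice for
    -- the value at `zero`. Otherwise the value at `zero` is irrelevant and induction applies. The
    -- injections `σ` and `τ` make room for the shifts of the matrix columns.
    count-collide : {y y′ : Fin n} → y ≢ y′ → w * count (collide? y y′) ≤ w ^ n
    count-collide {y = zero}  {zero}   y≢y′ = contradiction refl y≢y′
    count-collide {y = zero}  {suc y′} y≢y′ = ℕ.*-monoʳ-≤ w
      (count-fibrewise-unique (λ i g → σ i F.≟ τ (finToFun g y′)) λ p q → σ-inj (trans p (sym q)))
    count-collide {y = suc y} {zero}   y≢y′ = ℕ.*-monoʳ-≤ w
      (count-fibrewise-unique (λ i g → σ (finToFun g y) F.≟ τ i) λ p q → τ-inj (trans (sym p) q))
    count-collide {suc n} {suc y} {suc y′} y≢y′ = ℕ.*-monoʳ-≤ w (begin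
      count (collide? (suc y) (suc y′))         ≡⟨ sum-remQuot w (λ _ g → χ (collide? y y′ g)) ⟩
      sum {w} (λ _ → count (collide? y y′))     ≡⟨ sum-const w _ ⟩
      w * count (collide? y y′)                 ≤⟨ count-collide (y≢y′ ∘ cong suc) ⟩
      w ^ n                                     ∎)
      where open ℕ.≤-Reasoning

    -- Equal points get the trivial bound, charged to the `χ` term, so that the estimate can be
    -- summed over hash functions that may or may not have merged the two keys.
    count-collide′ : (y y′ : Fin n) → w * count (collide? y y′) ≤ w ^ n + w * w ^ n * χ (y F.≟ y′)
    count-collide′ {n} y y′ with y F.≟ y′
    ... | no  y≢y′ = ℕ.≤-trans (count-collide y≢y′) (ℕ.m≤m+n _ _)
    ... | yes _    = begin
      w * count (collide? y y′)     ≤⟨ ℕ.*-monoʳ-≤ w (sum-mono-≤ (χ≤1 ∘ collide? y y′)) ⟩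
      w * sum {w ^ n} (λ _ → 1)     ≡⟨ cong (w *_) (sum-const (w ^ n) 1) ⟩
      w * (w ^ n * 1)               ≡⟨ ℕ.*-assoc w (w ^ n) 1 ⟨
      w * w ^ n * 1                 ≤⟨ ℕ.m≤n+m _ _ ⟩
      w ^ n + w * w ^ n * 1         ∎
      where open ℕ.≤-Reasoning

    -- Union bound for a random `h` followed by a random map: either `h` has already merged the two
    -- keys, with probability at most k / m, or the map merges distinct values, with probability at
    -- most 1 / w.
    count-collide-compose : ∀ m k (y y′ : Fin a → Fin n) → m * count (λ h → y h F.≟ y′ h) ≤ k * a →
      w * m * count (λ i → let f , h = remQuot {w ^ n} a i in collide? (y h) (y′ h) f)
        ≤ (m + w * k) * (w ^ n * a)
    count-collide-compose {a} {n} m k y y′ few = begin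
      w * m * count (λ i → let f , h = remQuot {w ^ n} a i in collide? (y h) (y′ h) f)
        ≡⟨ cong (w * m *_) (sum-remQuot (w ^ n) (λ f h → χ (collide? (y h) (y′ h) f))) ⟩
      w * m * sum (λ f → sum λ h → χ (collide? (y h) (y′ h) f))
        ≡⟨ cong (w * m *_) (∑-comm {w ^ n} {a} (λ f h → χ (collide? (y h) (y′ h) f))) ⟩
      w * m * sum (λ h → count (collide? (y h) (y′ h)))
        ≡⟨ rearrange₁ w m _ ⟩
      m * (w * sum (λ h → count (collide? (y h) (y′ h))))
        ≡⟨ cong (m *_) (*-distribˡ-sum w (λ h → count (collide? (y h) (y′ h)))) ⟩
      m * sum (λ h → w * count (collide? (y h) (y′ h)))
        ≤⟨ ℕ.*-monoʳ-≤ m (sum-mono-≤ λ h → count-collide′ (y h) (y′ h)) ⟩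
      m * sum (λ h → w ^ n + w * w ^ n * χ (y h F.≟ y′ h))
        ≡⟨ cong (m *_) (∑-distrib-+ {a} (λ _ → w ^ n) _) ⟩
      m * (sum {a} (λ _ → w ^ n) + sum (λ h → w * w ^ n * χ (y h F.≟ y′ h)))
        ≡⟨ cong (m *_) (cong₂ _+_ (sum-const a (w ^ n)) (sym (*-distribˡ-sum (w * w ^ n) (λ h → χ (y h F.≟ y′ h))))) ⟩
      m * (a * w ^ n + w * w ^ n * count (λ h → y h F.≟ y′ h))
        ≡⟨ rearrange₂ m a (w ^ n) w _ ⟩
      m * (w ^ n * a) + w * w ^ n * (m * count (λ h → y h F.≟ y′ h))
        ≤⟨ ℕ.+-monoʳ-≤ (m * (w ^ n * a)) (ℕ.*-monoʳ-≤ (w * w ^ n) few) ⟩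
      m * (w ^ n * a) + w * w ^ n * (k * a)
        ≡⟨ rearrange₃ m (w ^ n) a w k ⟩
      (m + w * k) * (w ^ n * a) ∎
      where
      open ℕ.≤-Reasoning
      rearrange₁ : ∀ w m c → w * m * c ≡ m * (w * c)
      rearrange₁ = solve-∀
      rearrange₂ : ∀ m a N w c → m * (a * N + w * N * c) ≡ m * (N * a) + w * N * (m * c)
      rearrange₂ = solve-∀
      rearrange₃ : ∀ m N a w k → m * (N * a) + w * N * (k * a) ≡ (m + w * k) * (N * a)
      rearrange₃ = solve-∀

  -- a functions from b keys to m values, with collision probability at most k / m.
  record Hash (a b m k : ℕ) : Set where
    field
      hash   : Fin a → Fin b → Fin m
      sparse : ∀ {x y} → x ≢ y → m * count (λ i → hash i x F.≟ hash i y) ≤ k * a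

  open Hash

  identity-hash : ∀ m → Hash 1 m m 0
  identity-hash m = record
    { hash   = λ _ x → x
    ; sparse = λ x≢y → ℕ.≤-reflexive
        (trans (cong (m *_) (count-none {1} (λ _ → _ F.≟ _) λ _ → x≢y)) (ℕ.*-zeroʳ m))
    }

  -- Both halves of a key are hashed by the same `h`, and an arbitrary map merges the two values.
  -- Distinct keys differ in some half, so by `sparse` their pairs of values agree with probability
  -- at most k / m; the merging map adds at most 1 / m.
  double-hash : .{{_ : NonZero m}} → Hash a b m k → Hash (m ^ (m * m) * a) (b * b) m (suc k)
  double-hash {m} {a} {b} {k} H = record { hash = hash₂ ; sparse = sparse₂ }
    where
    open ℕ.≤-Reasoning

    pair : Fin a → Fin b × Fin b → Fin (m * m)
    pair h (x₁ , x₂) = combine (hash H h x₁) (hash H h x₂)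

    hash₂ : Fin (m ^ (m * m) * a) → Fin (b * b) → Fin m
    hash₂ i x = let f , h = remQuot {m ^ (m * m)} a i in finToFun f (pair h (remQuot {b} b x))

    pairs-agree? : ∀ x y → Decidable λ h → pair h x ≡ pair h y
    pairs-agree? x y h = pair h x F.≟ pair h y

    few-pairs : ∀ {x y} → x ≢ y → m * count (pairs-agree? x y) ≤ k * a
    few-pairs {x₁ , x₂} {y₁ , y₂} x≢y with x₁ F.≟ y₁
    ... | no x₁≢y₁ = ℕ.≤-trans
      (ℕ.*-monoʳ-≤ m (count-⊆ (pairs-agree? (x₁ , x₂) (y₁ , y₂)) (λ h → hash H h x₁ F.≟ hash H h y₁)
        (F.combine-injectiveˡ _ _ _ _)))
      (sparse H x₁≢y₁)
    ... | yes refl = ℕ.≤-trans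
      (ℕ.*-monoʳ-≤ m (count-⊆ (pairs-agree? (x₁ , x₂) (x₁ , y₂)) (λ h → hash H h x₂ F.≟ hash H h y₂)
        (λ {h} → F.combine-injectiveʳ (hash H h x₁) _ _ _)))
      (sparse H (x≢y ∘ cong (x₁ ,_)))

    remQuot-injective : ∀ {x y} → remQuot {b} b x ≡ remQuot b y → x ≡ y
    remQuot-injective {x} {y} eq = trans (sym (F.combine-remQuot {b} b x))
      (trans (cong (uncurry combine) eq) (F.combine-remQuot {b} b y))

    sparse₂ : ∀ {x y} → x ≢ y → m * count (λ i → hash₂ i x F.≟ hash₂ i y) ≤ suc k * (m ^ (m * m) * a)
    sparse₂ {x} {y} x≢y = ℕ.*-cancelˡ-≤ m (begin
      m * (m * count (λ i → hash₂ i x F.≟ hash₂ i y)) ≡⟨ ℕ.*-assoc m m _ ⟨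
      m * m * count (λ i → hash₂ i x F.≟ hash₂ i y)
        ≤⟨ count-collide-compose id id m k 
             (λ h → pair h (remQuot {b} b x)) (λ h → pair h (remQuot {b} b y))
             (few-pairs (x≢y ∘ remQuot-injective)) ⟩
      (m + m * k) * (m ^ (m * m) * a)      ≡⟨ cong (_* (m ^ (m * m) * a)) (ℕ.*-suc m k) ⟨
      m * suc k * (m ^ (m * m) * a)        ≡⟨ ℕ.*-assoc m (suc k) _ ⟩
      m * (suc k * (m ^ (m * m) * a))      ∎)

  functions keys : ℕ → ℕ → ℕ
  functions m zero    = 1
  functions m (suc k) = m ^ (m * m) * functions m k
  keys m zero    = m
  keys m (suc k) = keys m k * keys m k

  tree-hash : ∀ m .{{_ : NonZero m}} k → Hash (functions m k) (keys m k) m k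
  tree-hash m zero    = identity-hash m
  tree-hash m (suc k) = double-hash (tree-hash m k)

  -- 3-graphs from a colouring at each vertex

  ∣⁅x⁆∪p∣ : {x : Fin n} {p : Subset n} → x ∉ p → ∣ ⁅ x ⁆ ∪ p ∣ ≡ suc ∣ p ∣
  ∣⁅x⁆∪p∣ {x = zero}  {inside  ∷ p} x∉p = contradiction here x∉p
  ∣⁅x⁆∪p∣ {x = zero}  {outside ∷ p} x∉p = cong (suc ∘ ∣_∣) (∪-identityˡ p)
  ∣⁅x⁆∪p∣ {x = suc x} {inside  ∷ p} x∉p = cong suc (∣⁅x⁆∪p∣ (x∉p ∘ there))
  ∣⁅x⁆∪p∣ {x = suc x} {outside ∷ p} x∉p = ∣⁅x⁆∪p∣ (x∉p ∘ there)

  ∣⁅x⁆∪⁅y⁆∣≡2 : {x y : Fin n} → x ≢ y → ∣ ⁅ x ⁆ ∪ ⁅ y ⁆ ∣ ≡ 2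
  ∣⁅x⁆∪⁅y⁆∣≡2 {y = y} x≢y = trans (∣⁅x⁆∪p∣ (x≢y ∘ x∈⁅y⁆⇒x≡y y)) (cong suc (∣⁅x⁆∣≡1 y))

  ∈-triple⁻ : {x : Fin n} (u v w : Fin n) → x ∈ ⁅ u ⁆ ∪ ⁅ v ⁆ ∪ ⁅ w ⁆ → x ≡ u ⊎ x ≡ v ⊎ x ≡ w
  ∈-triple⁻ u v w x∈ with x∈p∪q⁻ ⁅ u ⁆ _ x∈
  ... | inj₁ x∈u = inj₁ (x∈⁅y⁆⇒x≡y u x∈u)
  ... | inj₂ x∈vw with x∈p∪q⁻ ⁅ v ⁆ _ x∈vw
  ...   | inj₁ x∈v = inj₂ (inj₁ (x∈⁅y⁆⇒x≡y v x∈v))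
  ...   | inj₂ x∈w = inj₂ (inj₂ (x∈⁅y⁆⇒x≡y w x∈w))

  ∣triple∣≡3 : {u v w : Fin n} → u ≢ v → u ≢ w → v ≢ w → ∣ ⁅ u ⁆ ∪ ⁅ v ⁆ ∪ ⁅ w ⁆ ∣ ≡ 3
  ∣triple∣≡3 {u = u} {v} {w} u≢v u≢w v≢w = trans (∣⁅x⁆∪p∣ u∉vw) (cong suc (∣⁅x⁆∪⁅y⁆∣≡2 v≢w))
    where
    u∉vw : u ∉ ⁅ v ⁆ ∪ ⁅ w ⁆
    u∉vw u∈ with x∈p∪q⁻ ⁅ v ⁆ _ u∈
    ... | inj₁ u∈v = u≢v (x∈⁅y⁆⇒x≡y v u∈v)
    ... | inj₂ u∈w = u≢w (x∈⁅y⁆⇒x≡y w u∈w)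

  ∈-image : (f : Fin m → Fin n) (e : Subset m) {x : Fin m} → x ∈ e → f x ∈ image f e
  ∈-image f e {x} x∈e = lookup⇒[]= (f x) _
    (trans (lookup∘tabulate _ (f x)) (dec-true (F.any? λ x′ → (x′ ∈? e) ×-dec (f x′ F.≟ f x)) (x , x∈e , refl)))

  module Colouring (c : Fin n → Fin n → Fin t) where

    Distinct-in : Subset n → Fin n → Fin n → Fin n → Set
    Distinct-in e x y z = (x ∈ e × y ∈ e × z ∈ e) × x ≢ y × x ≢ z × y ≢ z

    Distinct-in? : ∀ e x y z → Dec (Distinct-in e x y z)
    Distinct-in? e x y z =
      ((x ∈? e) ×-dec (y ∈? e) ×-dec (z ∈? e)) ×-dec
      ¬? (x F.≟ y) ×-dec ¬? (x F.≟ z) ×-dec ¬? (y F.≟ z)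

    -- c x is a proper colouring of the link of x; the value c x x is irrelevant.
    properly-coloured : Hypergraph 3 n
    properly-coloured = record
      { Edge    = λ e → ∣ e ∣ ≡ 3 × ∀ x y z → Distinct-in e x y z → c x y ≢ c x z
      ; edge?   = λ e → (∣ e ∣ ℕ.≟ 3) ×-dec F.all? λ x → F.all? λ y → F.all? λ z →
          Distinct-in? e x y z →-dec ¬? (c x y F.≟ c x z)
      ; uniform = proj₁
      }

    -- The colouring at the image of the apex has `t` colours for `suc t` vertices. Two of them
    -- share a colour, yet with the apex they form a 3-edge.
    no-suspension : ¬ Contains (n , properly-coloured) (suspension (complete (suc t)))
    no-suspension (f , f-inj , f-edges)
      with F.pigeonhole (ℕ.n<1+n t) (λ i → c (f zero) (f (suc i)))
    ... | i , j , i<j , same = proj₂ (f-edges e (∣⁅x⁆∪⁅y⁆∣≡2 (F.<⇒≢ i<j)))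
      (f zero) (f (suc i)) (f (suc j))
      ( ( ∈-image f e here
        , ∈-image f e (there (x∈p∪q⁺ (inj₁ (x∈⁅x⁆ i))))
        , ∈-image f e (there (x∈p∪q⁺ (inj₂ (x∈⁅x⁆ j)))))
      , F.0≢1+n ∘ f-inj
      , F.0≢1+n ∘ f-inj
      , F.<⇒≢ i<j ∘ F.suc-injective ∘ f-inj
      ) same
      where e = inside ∷ ⁅ i ⁆ ∪ ⁅ j ⁆

    Rainbow : Fin n → Fin n → Pred (Fin n) _
    Rainbow u v w = c u v ≢ c u w × c v u ≢ c v w × c w u ≢ c w v

    Rainbow? : ∀ u v → Decidable (Rainbow u v)
    Rainbow? u v w = ¬? (c u v F.≟ c u w) ×-dec ¬? (c v u F.≟ c v w) ×-dec ¬? (c w u F.≟ c w v)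

    Rainbow⇒Edge : ∀ {u v w} → u ≢ v → w ≢ u → w ≢ v → Rainbow u v w →
                   Edge properly-coloured (⁅ u ⁆ ∪ ⁅ v ⁆ ∪ ⁅ w ⁆)
    Rainbow⇒Edge {u} {v} {w} u≢v w≢u w≢v (at-u , at-v , at-w) =
      ∣triple∣≡3 u≢v (w≢u ∘ sym) (w≢v ∘ sym) , λ x y z ((x∈ , y∈ , z∈) , x≢y , x≢z , y≢z) →
        proper x≢y x≢z y≢z (∈-triple⁻ u v w x∈) (∈-triple⁻ u v w y∈) (∈-triple⁻ u v w z∈)
      where
      proper : ∀ {x y z} → x ≢ y → x ≢ z → y ≢ z →
        x ≡ u ⊎ x ≡ v ⊎ x ≡ w → y ≡ u ⊎ y ≡ v ⊎ y ≡ w → z ≡ u ⊎ z ≡ v ⊎ z ≡ w → c x y ≢ c x z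
      proper x≢y x≢z y≢z (inj₁ refl) (inj₁ refl) _ = contradiction refl x≢y
      proper x≢y x≢z y≢z (inj₂ (inj₁ refl)) (inj₂ (inj₁ refl)) _ = contradiction refl x≢y
      proper x≢y x≢z y≢z (inj₂ (inj₂ refl)) (inj₂ (inj₂ refl)) _ = contradiction refl x≢y
      proper x≢y x≢z y≢z (inj₁ refl) _ (inj₁ refl) = contradiction refl x≢z
      proper x≢y x≢z y≢z (inj₂ (inj₁ refl)) _ (inj₂ (inj₁ refl)) = contradiction refl x≢z
      proper x≢y x≢z y≢z (inj₂ (inj₂ refl)) _ (inj₂ (inj₂ refl)) = contradiction refl x≢z
      proper x≢y x≢z y≢z _ (inj₁ refl) (inj₁ refl) = contradiction refl y≢z
      proper x≢y x≢z y≢z _ (inj₂ (inj₁ refl)) (inj₂ (inj₁ refl)) = contradiction refl y≢z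
      proper x≢y x≢z y≢z _ (inj₂ (inj₂ refl)) (inj₂ (inj₂ refl)) = contradiction refl y≢z
      -- Only the six orderings of `u`, `v`, `w` remain; `sym` serves those that list the last two
      -- in the opposite order.
      proper x≢y x≢z y≢z (inj₁ refl) (inj₂ (inj₁ refl)) (inj₂ (inj₂ refl)) = at-u
      proper x≢y x≢z y≢z (inj₁ refl) (inj₂ (inj₂ refl)) (inj₂ (inj₁ refl)) = at-u ∘ sym
      proper x≢y x≢z y≢z (inj₂ (inj₁ refl)) (inj₁ refl) (inj₂ (inj₂ refl)) = at-v
      proper x≢y x≢z y≢z (inj₂ (inj₁ refl)) (inj₂ (inj₂ refl)) (inj₁ refl) = at-v ∘ sym
      proper x≢y x≢z y≢z (inj₂ (inj₂ refl)) (inj₁ refl) (inj₂ (inj₁ refl)) = at-w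
      proper x≢y x≢z y≢z (inj₂ (inj₂ refl)) (inj₂ (inj₁ refl)) (inj₁ refl) = at-w ∘ sym

    -- The values `c x x` are arbitrary, so `w ≡ u` and `w ≡ v` may satisfy `Rainbow` without giving
    -- a 3-edge; these account for the 2.
    count-Rainbow≤codegree+2 : ∀ {u v} → u ≢ v →
      count (Rainbow? u v) ≤ codegree properly-coloured u v + 2
    count-Rainbow≤codegree+2 {u} {v} u≢v = begin
      count (Rainbow? u v)
        ≤⟨ sum-mono-≤ pointwise ⟩
      sum (λ w → χ (e? w) + (χ (w F.≟ u) + χ (w F.≟ v)))
        ≡⟨ ∑-distrib-+ (χ ∘ e?) _ ⟩
      count e? + sum (λ w → χ (w F.≟ u) + χ (w F.≟ v))
        ≡⟨ cong₂ _+_ (sym (∣subset∣ e?)) (∑-distrib-+ (λ w → χ (w F.≟ u)) _) ⟩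
      codegree properly-coloured u v + (count (F._≟ u) + count (F._≟ v))
        ≤⟨ ℕ.+-monoʳ-≤ _ (ℕ.+-mono-≤ (count-unique (F._≟ u) λ p q → trans p (sym q))
                                     (count-unique (F._≟ v) λ p q → trans p (sym q))) ⟩
      codegree properly-coloured u v + 2 ∎
      where
      open ℕ.≤-Reasoning
      e? : Decidable λ w → Edge properly-coloured (⁅ u ⁆ ∪ ⁅ v ⁆ ∪ ⁅ w ⁆)
      e? w = edge? properly-coloured (⁅ u ⁆ ∪ ⁅ v ⁆ ∪ ⁅ w ⁆)

      pointwise : ∀ w → χ (Rainbow? u v w) ≤ χ (e? w) + (χ (w F.≟ u) + χ (w F.≟ v))
      pointwise w with w F.≟ u | w F.≟ v
      ... | yes _  | _      = ℕ.≤-trans (χ≤1 (Rainbow? u v w)) (ℕ.≤-trans (s≤s z≤n) (ℕ.m≤n+m _ (χ (e? w))))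
      ... | no  _  | yes _  = ℕ.≤-trans (χ≤1 (Rainbow? u v w)) (ℕ.m≤n+m _ (χ (e? w)))
      ... | no w≢u | no w≢v = ℕ.≤-trans (χ-mono (Rainbow? u v w) (e? w) (Rainbow⇒Edge u≢v w≢u w≢v))
                                        (ℕ.m≤m+n _ 0)

  -- Addition modulo `t` and the shifted construction

  _⊕_ : .{{_ : NonZero t}} → Fin t → Fin t → Fin t
  _⊕_ {t} i j = (toℕ i + toℕ j) mod t

  -- Adding `t ∸ toℕ k` undoes the addition of `k` modulo `t`.
  ⊕-cancelʳ : .{{_ : NonZero t}} (k : Fin t) {i j : Fin t} → i ⊕ k ≡ j ⊕ k → i ≡ j
  ⊕-cancelʳ {t} k {i} {j} eq = F.toℕ-injective (begin
    toℕ i                                  ≡⟨ recover i ⟨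
    ((toℕ i + toℕ k) % t + l % t) % t      ≡⟨ cong (λ x → (x + l % t) % t) sum-eq ⟩
    ((toℕ j + toℕ k) % t + l % t) % t      ≡⟨ recover j ⟩
    toℕ j                                  ∎)
    where
    open ≡-Reasoning
    l = t ∸ toℕ k

    sum-eq : (toℕ i + toℕ k) % t ≡ (toℕ j + toℕ k) % t
    sum-eq = trans (sym (F.toℕ-fromℕ< _)) (trans (cong toℕ eq) (F.toℕ-fromℕ< _))

    recover : ∀ i → ((toℕ i + toℕ k) % t + l % t) % t ≡ toℕ i
    recover i = begin
      ((toℕ i + toℕ k) % t + l % t) % t   ≡⟨ %-distribˡ-+ (toℕ i + toℕ k) l t ⟨
      (toℕ i + toℕ k + l) % t             ≡⟨ cong (_% t) (ℕ.+-assoc (toℕ i) (toℕ k) l) ⟩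
      (toℕ i + (toℕ k + l)) % t           ≡⟨ cong (λ x → (toℕ i + x) % t) (ℕ.m+[n∸m]≡n (ℕ.<⇒≤ (F.toℕ<n k))) ⟩
      (toℕ i + t) % t                     ≡⟨ [m+n]%n≡m%n (toℕ i) t ⟩
      toℕ i % t                           ≡⟨ m<n⇒m%n≡m (F.toℕ<n i) ⟩
      toℕ i                               ∎

  ⊕-cancelˡ : .{{_ : NonZero t}} (k : Fin t) {i j : Fin t} → k ⊕ i ≡ k ⊕ j → i ≡ j
  ⊕-cancelˡ {t} k {i} {j} eq = ⊕-cancelʳ k (trans (⊕-comm i) (trans eq (sym (⊕-comm j))))
    where
    ⊕-comm : ∀ i → i ⊕ k ≡ k ⊕ i
    ⊕-comm i = F.fromℕ<-cong _ _ (cong (_% t) (ℕ.+-comm (toℕ i) (toℕ k))) _ _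

  *-χ-≤ : ∀ {d k} {P : Set} (P? : Dec P) → (P → d ≤ k) → d * χ P? ≤ k
  *-χ-≤ {d} (yes p) d≤k = ℕ.≤-trans (ℕ.≤-reflexive (ℕ.*-identityʳ d)) (d≤k p)
  *-χ-≤ {d} (no _)  d≤k = ℕ.≤-trans (ℕ.≤-reflexive (ℕ.*-zeroʳ d)) z≤n

  module Shifted .{{_ : NonZero t}} (M : Fin r → Fin r → Fin t) where

    Shift-agree? : ∀ x a y b → Decidable λ h → M h x ⊕ a ≡ M h y ⊕ b
    Shift-agree? x a y b h = M h x ⊕ a F.≟ M h y ⊕ b


    vertex : Fin (r * t) → Fin r × Fin t
    vertex = remQuot {r} t

    vertex-injective : ∀ {x y} → vertex x ≡ vertex y → x ≡ y
    vertex-injective {x} {y} eq = trans (sym (F.combine-remQuot {r} t x))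
      (trans (cong (uncurry combine) eq) (F.combine-remQuot {r} t y))

    colour : Fin r × Fin t → Fin r × Fin t → Fin t
    colour (h , _) (x , a) = M h x ⊕ a

    open Colouring (λ x y → colour (vertex x) (vertex y))

    separates? : ∀ u v → Decidable λ h → M h (proj₁ u) ⊕ proj₂ u ≢ M h (proj₁ v) ⊕ proj₂ v
    separates? (x , a) (y , b) h = ¬? (Shift-agree? x a y b h)

    Sparse : ℕ → ℕ → Set
    Sparse p q = ∀ {x y} → x ≢ y → ∀ a b → p * count (Shift-agree? x a y b) ≤ q * r

    -- For different indices this is `Sparse`. Vertices with the same index have different shifts,
    -- so by cancellation every `h` separates them.
    count-separates : ∀ p q → Sparse p q → ∀ {u v} → u ≢ v → p * r ≤ p * count (separates? u v) + q * r
    count-separates p q few {u@(x , a)} {v@(y , b)} u≢v = begin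
      p * r                                                         ≡⟨ cong (p *_) total ⟨
      p * (count (separates? u v) + count (Shift-agree? x a y b))   ≡⟨ ℕ.*-distribˡ-+ p _ _ ⟩
      p * count (separates? u v) + p * count (Shift-agree? x a y b) ≤⟨ ℕ.+-monoʳ-≤ _ few′ ⟩
      p * count (separates? u v) + q * r                            ∎
      where
      open ℕ.≤-Reasoning
      χ-¬ : ∀ {P : Set} (P? : Dec P) → χ (¬? P?) + χ P? ≡ 1
      χ-¬ (yes _) = refl
      χ-¬ (no  _) = refl

      total : count (separates? u v) + count (Shift-agree? x a y b) ≡ r
      total = trans (sym (∑-distrib-+ (χ ∘ separates? u v) _))
        (trans (sum-cong-≗ (χ-¬ ∘ Shift-agree? x a y b)) (trans (sum-const r 1) (ℕ.*-identityʳ r)))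

      few′ : p * count (Shift-agree? x a y b) ≤ q * r
      few′ with x F.≟ y
      ... | no x≢y = few x≢y a b
      ... | yes refl = ℕ.≤-trans (ℕ.≤-reflexive (trans
        (cong (p *_) (count-none (Shift-agree? x a y b) λ h eq → u≢v (cong (x ,_) (⊕-cancelˡ (M h x) eq))))
        (ℕ.*-zeroʳ p))) z≤n

    rainbow? : ∀ u v w → Dec (colour u v ≢ colour u w × colour v u ≢ colour v w × colour w u ≢ colour w v)
    rainbow? u v w = ¬? (colour u v F.≟ colour u w) ×-dec ¬? (colour v u F.≟ colour v w) ×-dec
      ¬? (colour w u F.≟ colour w v)

    -- As `b` varies, the colour of `(h , b)` seen from `u` takes no value twice, so at most one `b`
    -- fails at `u`; likewise at `v`. The condition at `(h , b)` itself does not involve `b` and is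
    -- the separation by `h`.
    count-completions : ∀ u v h → (t ∸ 2) * χ (separates? u v h) ≤ count λ b → rainbow? u v (h , b)
    count-completions u v h = *-χ-≤ (separates? u v h) λ separates → ℕ.m≤n+o⇒m∸n≤o t 2 (begin
      t                                             ≡⟨ trans (sum-const t 1) (ℕ.*-identityʳ t) ⟨
      sum {t} (λ _ → 1)                             ≤⟨ sum-mono-≤ (pointwise separates) ⟩
      sum (λ b → χ (u-bad? b) + χ (v-bad? b) + χ (rainbow? u v (h , b)))
        ≡⟨ ∑-distrib-+ (λ b → χ (u-bad? b) + χ (v-bad? b)) _ ⟩
      sum (λ b → χ (u-bad? b) + χ (v-bad? b)) + count (λ b → rainbow? u v (h , b))
        ≡⟨ cong (_+ count (λ b → rainbow? u v (h , b))) (∑-distrib-+ (χ ∘ u-bad?) _) ⟩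
      count u-bad? + count v-bad? + count (λ b → rainbow? u v (h , b))
        ≤⟨ ℕ.+-monoˡ-≤ _ (ℕ.+-mono-≤
             (count-unique u-bad? λ p q → ⊕-cancelˡ (M (proj₁ u) h) (trans (sym p) q))
             (count-unique v-bad? λ p q → ⊕-cancelˡ (M (proj₁ v) h) (trans (sym p) q))) ⟩
      2 + count (λ b → rainbow? u v (h , b)) ∎)
      where
      open ℕ.≤-Reasoning
      u-bad? : Decidable λ b → colour u v ≡ colour u (h , b)
      u-bad? b = colour u v F.≟ colour u (h , b)
      v-bad? : Decidable λ b → colour v u ≡ colour v (h , b)
      v-bad? b = colour v u F.≟ colour v (h , b)

      cover : ∀ {P Q R : Set} (P? : Dec P) (Q? : Dec Q) (R? : Dec R) →
              (¬ P → ¬ Q → R) → 1 ≤ χ P? + χ Q? + χ R?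
      cover (yes _) _       _  f = s≤s z≤n
      cover (no _)  (yes _) _  f = s≤s z≤n
      cover (no ¬p) (no ¬q) R? f = ℕ.≤-reflexive (sym (χ-yes R? (f ¬p ¬q)))

      pointwise : M h (proj₁ u) ⊕ proj₂ u ≢ M h (proj₁ v) ⊕ proj₂ v →
                  ∀ b → 1 ≤ χ (u-bad? b) + χ (v-bad? b) + χ (rainbow? u v (h , b))
      pointwise separates b = cover (u-bad? b) (v-bad? b) (rainbow? u v (h , b))
        λ at-u at-v → at-u , at-v , separates

    -- Summing `count-completions` over `h` gives at least `t ∸ 2` rainbow vertices per separating
    -- `h`, and `count-separates` bounds the number of those. Everything is multiplied by `p` and
    -- kept free of subtraction.
    codegree-bound : ∀ p q → Sparse p q → ∀ {u v} → u ≢ v →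
      (t ∸ 2) * (p * r) ≤ p * (codegree properly-coloured u v + 2) + (t ∸ 2) * (q * r)
    codegree-bound p q few {u} {v} u≢v = begin
      (t ∸ 2) * (p * r)
        ≤⟨ ℕ.*-monoʳ-≤ (t ∸ 2) (count-separates p q few {vertex u} {vertex v} (u≢v ∘ vertex-injective)) ⟩
      (t ∸ 2) * (p * S + q * r)
        ≡⟨ rearrange (t ∸ 2) p S (q * r) ⟩
      p * ((t ∸ 2) * S) + (t ∸ 2) * (q * r)
        ≤⟨ ℕ.+-monoˡ-≤ _ (ℕ.*-monoʳ-≤ p (begin
          (t ∸ 2) * S
            ≡⟨ *-distribˡ-sum (t ∸ 2) (χ ∘ separates? (vertex u) (vertex v)) ⟩
          sum (λ h → (t ∸ 2) * χ (separates? (vertex u) (vertex v) h))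
            ≤⟨ sum-mono-≤ (count-completions (vertex u) (vertex v)) ⟩
          sum (λ h → sum λ b → χ (rainbow? (vertex u) (vertex v) (h , b)))
            ≡⟨ sum-remQuot r (λ h b → χ (rainbow? (vertex u) (vertex v) (h , b))) ⟨
          count (Rainbow? u v)
            ≤⟨ count-Rainbow≤codegree+2 u≢v ⟩
          codegree properly-coloured u v + 2 ∎)) ⟩
      p * (codegree properly-coloured u v + 2) + (t ∸ 2) * (q * r) ∎
      where
      open ℕ.≤-Reasoning
      S = count (separates? (vertex u) (vertex v))
      rearrange : ∀ D p S x → D * (p * S + x) ≡ p * (D * S) + D * x
      rearrange = solve-∀

  -- Sparse matrices and the choice of parameters

  -- Agreement in at most a fraction (C + t) / (t C) = 1 / t + 1 / C of the rows.
  NearlyBalanced : .{{_ : NonZero t}} → ℕ → (Fin r → Fin r → Fin t) → Set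
  NearlyBalanced {t} C M = Shifted.Sparse M (t * C) (C + t)

  -- A row is a hash function followed by a map `Fin m → Fin t`; the columns are as many of the `b`
  -- keys as there are rows. Shifted columns agree with probability at most 1 / t + k / m, and k / m
  -- is at most 1 / C.
  hash-matrix : ∀ .{{_ : NonZero t}} {C} .{{_ : NonZero m}} → Hash a b m k → t ^ m * a ≤ b → k * C ≤ m →
    ∃₂ λ (r : ℕ) (M : Fin r → Fin r → Fin t) → r ≡ t ^ m * a × NearlyBalanced C M
  hash-matrix {t} {m} {a} {b} {k} {C} H r≤b kC≤m = t ^ m * a , M , refl , balanced
    where
    open ℕ.≤-Reasoning
    key = λ x → inject≤ {t ^ m * a} {b} x r≤b

    M : Fin (t ^ m * a) → Fin (t ^ m * a) → Fin t
    M i x = let f , h = remQuot {t ^ m} a i in finToFun f (hash H h (key x))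

    rearrange₁ : ∀ m t C s → m * (t * C * s) ≡ t * m * s * C
    rearrange₁ = solve-∀
    rearrange₂ : ∀ m t k r C → (m + t * k) * r * C ≡ m * C * r + t * r * (k * C)
    rearrange₂ = solve-∀
    rearrange₃ : ∀ m t r C → m * C * r + t * r * m ≡ m * ((C + t) * r)
    rearrange₃ = solve-∀

    balanced : NearlyBalanced C M
    balanced {x} {y} x≢y a′ b′ = ℕ.*-cancelˡ-≤ m (begin
      m * (t * C * s)
        ≡⟨ rearrange₁ m t C s ⟩
      t * m * s * C
        ≤⟨ ℕ.*-monoˡ-≤ C (count-collide-compose (⊕-cancelʳ a′) (⊕-cancelʳ b′) m k
             (λ h → hash H h (key x)) (λ h → hash H h (key y))
             (sparse H (x≢y ∘ F.inject≤-injective r≤b r≤b x y))) ⟩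
      (m + t * k) * (t ^ m * a) * C
        ≡⟨ rearrange₂ m t k (t ^ m * a) C ⟩
      m * C * (t ^ m * a) + t * (t ^ m * a) * (k * C)
        ≤⟨ ℕ.+-monoʳ-≤ (m * C * (t ^ m * a)) (ℕ.*-monoʳ-≤ (t * (t ^ m * a)) kC≤m) ⟩
      m * C * (t ^ m * a) + t * (t ^ m * a) * m
        ≡⟨ rearrange₃ m t (t ^ m * a) C ⟩
      m * ((C + t) * (t ^ m * a)) ∎)
      where s = count (Shifted.Shift-agree? M x a′ y b′)

  functions≡^ : ∀ m k → functions m k ≡ m ^ (m * m * k)
  functions≡^ m zero    = cong (m ^_) (sym (ℕ.*-zeroʳ (m * m)))
  functions≡^ m (suc k) = trans (cong (m ^ (m * m) *_) (functions≡^ m k))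
    (trans (sym (ℕ.^-distribˡ-+-* m (m * m) (m * m * k))) (cong (m ^_) (sym (ℕ.*-suc (m * m) k))))

  keys≡^ : ∀ m k → keys m k ≡ m ^ (2 ^ k)
  keys≡^ m zero    = sym (ℕ.^-identityʳ m)
  keys≡^ m (suc k) = trans (cong₂ _*_ (keys≡^ m k) (keys≡^ m k))
    (trans (sym (ℕ.^-distribˡ-+-* m (2 ^ k) (2 ^ k))) (cong (λ x → m ^ (2 ^ k + x)) (sym (ℕ.+-identityʳ (2 ^ k)))))

  -- Compare exponents of `m`: each level of the tree adds `m * m` on the side of the functions but
  -- doubles the exponent of the keys. The factor `t ^ m` counts the final maps and costs at most
  -- `m` more.
  enough-keys : .{{_ : NonZero m}} → t ≤ m → m + m * m * k ≤ 2 ^ k → t ^ m * functions m k ≤ keys m k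
  enough-keys {m} {t} {k} t≤m few = begin
    t ^ m * functions m k      ≤⟨ ℕ.*-monoˡ-≤ _ (ℕ.^-monoˡ-≤ m t≤m) ⟩
    m ^ m * functions m k      ≡⟨ cong (m ^ m *_) (functions≡^ m k) ⟩
    m ^ m * m ^ (m * m * k)    ≡⟨ ℕ.^-distribˡ-+-* m m (m * m * k) ⟨
    m ^ (m + m * m * k)        ≤⟨ ℕ.^-monoʳ-≤ m few ⟩
    m ^ (2 ^ k)                ≡⟨ keys≡^ m k ⟨
    keys m k                   ∎
    where open ℕ.≤-Reasoning

  n≤2^n : ∀ n → n ≤ 2 ^ n
  n≤2^n zero    = z≤n
  n≤2^n (suc n) = ℕ.+-mono-≤ (ℕ.m^n>0 2 n) (ℕ.≤-trans (n≤2^n n) (ℕ.m≤m+n _ 0))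

  -- m = 4 ^ i values and k = 8 i doublings: k / m → 0, while 2 ^ k = m ^ 4 makes
  -- the keys outnumber the functions.
  parameters : ∀ C t N → ∃₂ λ m k →
    2 ≤ m × 1 ≤ k × t ≤ m × N ≤ m × k * suc C ≤ m × m + m * m * k ≤ 2 ^ k
  parameters C t N =
    size , depth , 2≤size , ℕ.≤-trans (s≤s z≤n) i≤depth ,
    ℕ.≤-trans t≤i i≤size , ℕ.≤-trans N≤i i≤size , kC≤size , exponents
    where
    open ℕ.≤-Reasoning
    -- The first summand yields `depth * suc C ≡ i * (8 * suc C) ≤ i * i ≤
    -- size`; the second puts `t` and `N` below `size`.
    i = 8 * suc C + (t + N)
    size = 2 ^ i * 2 ^ i
    -- Eight copies of `i`, bracketed so that `double` applies three times.
    depth = (i + i + (i + i)) + (i + i + (i + i))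

    t≤i : t ≤ i
    t≤i = ℕ.≤-trans (ℕ.m≤m+n t N) (ℕ.m≤n+m (t + N) (8 * suc C))
    N≤i : N ≤ i
    N≤i = ℕ.≤-trans (ℕ.m≤n+m N t) (ℕ.m≤n+m (t + N) (8 * suc C))
    8C≤i : 8 * suc C ≤ i
    8C≤i = ℕ.m≤m+n (8 * suc C) (t + N)
    i≤depth : i ≤ depth
    i≤depth = ℕ.≤-trans (ℕ.m≤m+n i i) (ℕ.≤-trans (ℕ.m≤m+n (i + i) (i + i)) (ℕ.m≤m+n _ _))
    ii≤size : i * i ≤ size
    ii≤size = ℕ.*-mono-≤ (n≤2^n i) (n≤2^n i)
    i≤size : i ≤ size
    i≤size = ℕ.≤-trans (ℕ.m≤m*n i i) ii≤size
    2≤size : 2 ≤ size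
    2≤size = ℕ.≤-trans (ℕ.≤-trans (ℕ.≤-trans (s≤s (s≤s z≤n)) (ℕ.m≤m*n 8 (suc C))) 8C≤i) i≤size
    kC≤size : depth * suc C ≤ size
    kC≤size = begin
      depth * suc C        ≡⟨ rearrange i (suc C) ⟩
      i * (8 * suc C)  ≤⟨ ℕ.*-monoʳ-≤ i 8C≤i ⟩
      i * i            ≤⟨ ii≤size ⟩
      size                ∎
      where
      rearrange : ∀ i c → (i + i + (i + i) + (i + i + (i + i))) * c ≡ i * (8 * c)
      rearrange = solve-∀
    2^depth : 2 ^ depth ≡ size * size * (size * size)
    2^depth = trans (double (i + i + (i + i))) (cong (λ x → x * x)
      (trans (double (i + i)) (cong (λ x → x * x) (double i))))
      where
      double : ∀ j → 2 ^ (j + j) ≡ 2 ^ j * 2 ^ j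
      double j = ℕ.^-distribˡ-+-* 2 j j
    1+size≤mm : 1 + size ≤ size * size
    1+size≤mm = begin
      1 + size   ≤⟨ ℕ.+-monoˡ-≤ size (ℕ.≤-trans (s≤s z≤n) 2≤size) ⟩
      size + size   ≡⟨ cong (size +_) (ℕ.+-identityʳ size) ⟨
      2 * size   ≤⟨ ℕ.*-monoˡ-≤ size 2≤size ⟩
      size * size   ∎
    exponents : size + size * size * depth ≤ 2 ^ depth
    exponents = begin
      size + size * size * depth          ≤⟨ ℕ.+-mono-≤ (ℕ.≤-trans (ℕ.n≤1+n size) 1+size≤mm)
                                  (ℕ.*-monoʳ-≤ (size * size) (ℕ.≤-trans (ℕ.m≤m*n depth (suc C)) kC≤size)) ⟩
      size * size + size * size * size      ≡⟨ ℕ.*-suc (size * size) size ⟨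
      size * size * suc size          ≤⟨ ℕ.*-monoʳ-≤ (size * size) 1+size≤mm ⟩
      size * size * (size * size)        ≡⟨ 2^depth ⟨
      2 ^ depth                  ∎

  matrix : ∀ t .{{_ : NonZero t}} C .{{_ : NonZero C}} N →
    ∃₂ λ (r : ℕ) (M : Fin r → Fin r → Fin t) → N ≤ r × NearlyBalanced C M
  matrix t C@(suc C′) N = build (parameters C′ t N)
    where
    open ℕ.≤-Reasoning
    build : (∃₂ λ m k → 2 ≤ m × 1 ≤ k × t ≤ m × N ≤ m × k * C ≤ m × m + m * m * k ≤ 2 ^ k) →
            ∃₂ λ (r : ℕ) (M : Fin r → Fin r → Fin t) → N ≤ r × NearlyBalanced C M
    build (m , k , 2≤m , 1≤k , t≤m , N≤m , kC≤m , exponents) =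
      let r , M , r≡ , balanced = hash-matrix (tree-hash m k) (enough-keys {k = k} t≤m exponents) kC≤m
      in r , M , ℕ.≤-trans N≤size (ℕ.≤-reflexive (sym r≡)) , balanced
      where
      instance
        m≢0 : NonZero m
        m≢0 = >-nonZero (ℕ.≤-trans (s≤s z≤n) 2≤m)
        k≢0 : NonZero k
        k≢0 = >-nonZero 1≤k
        mm≢0 : NonZero (m * m)
        mm≢0 = ℕ.m*n≢0 m m

      N≤size : N ≤ t ^ m * functions m k
      N≤size = begin
        N                           ≤⟨ N≤m ⟩
        m                           ≡⟨ ℕ.^-identityʳ m ⟨
        m ^ 1                       ≤⟨ ℕ.^-monoʳ-≤ m (ℕ.>-nonZero⁻¹ (m * m * k) {{ℕ.m*n≢0 (m * m) k}}) ⟩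
        m ^ (m * m * k)             ≡⟨ functions≡^ m k ⟨
        functions m k               ≡⟨ ℕ.*-identityˡ (functions m k) ⟨
        1 * functions m k           ≤⟨ ℕ.*-monoˡ-≤ (functions m k) (ℕ.m^n>0 t m) ⟩
        t ^ m * functions m k       ∎

  -- (A − B) / p − 2, the codegree that A ≤ p (g + 2) + B forces on g.
  rounded : ∀ p .{{_ : NonZero p}} → ℕ → ℕ → ℕ
  rounded p A B = (A ∸ B) / p ∸ 2

  rounded-lower : ∀ p .{{_ : NonZero p}} A B {g} → A ≤ p * (g + 2) + B → rounded p A B ≤ g
  rounded-lower p A B {g} A≤ = ℕ.m≤n+o⇒m∸n≤o ((A ∸ B) / p) 2 (ℕ.*-cancelʳ-≤ _ _ p (begin
    (A ∸ B) / p * p      ≤⟨ m/n*n≤m (A ∸ B) p ⟩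
    A ∸ B                ≤⟨ ℕ.m≤n+o⇒m∸n≤o A B (ℕ.≤-trans A≤ (ℕ.≤-reflexive (ℕ.+-comm (p * (g + 2)) B))) ⟩
    p * (g + 2)          ≡⟨ rearrange p g ⟩
    (2 + g) * p          ∎))
    where
    open ℕ.≤-Reasoning
    rearrange : ∀ p g → p * (g + 2) ≡ (2 + g) * p
    rearrange = solve-∀

  -- The 3 consists of the 2 subtracted in `rounded` and 1 for the remainder of the division.
  rounded-upper : ∀ p .{{_ : NonZero p}} A B → A ≤ p * (rounded p A B + 3) + B
  rounded-upper p A B = begin
    A                                  ≤⟨ ℕ.m≤n+m∸n A B ⟩
    B + L                              ≡⟨ cong (B +_) (m≡m%n+[m/n]*n L p) ⟩
    B + (L % p + L / p * p)            ≤⟨ ℕ.+-monoʳ-≤ B (ℕ.+-mono-≤ (ℕ.<⇒≤ (m%n<n L p))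
                                            (ℕ.*-monoˡ-≤ p (ℕ.m≤n+m∸n (L / p) 2))) ⟩
    B + (p + (2 + d) * p)              ≡⟨ rearrange p d B ⟩
    p * (d + 3) + B                    ∎
    where
    open ℕ.≤-Reasoning
    L = A ∸ B
    d = rounded p A B
    rearrange : ∀ p d B → B + (p + (2 + d) * p) ≡ p * (d + 3) + B
    rearrange = solve-∀

  -- Attainable codegrees

  -- The last component says that (d + 3) / n is at least (1 - 2 / t)(1 - 1 / t - 1 / C) when `t` is
  -- at least 2.
  matrix-attainable : ∀ .{{_ : NonZero t}} C .{{_ : NonZero C}} (M : Fin r → Fin r → Fin t) → NearlyBalanced C M →
    ∃₂ λ n d → n ≡ r * t × Attainable ｛ suspension (complete (suc t)) ｝ n d ×
    (t ∸ 2) * (t * C * r) ≤ t * C * (d + 3) + (t ∸ 2) * ((C + t) * r)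
  matrix-attainable {t} {r} C M balanced =
    r * t , rounded (t * C) A B , refl ,
    (properly-coloured , enough , λ { _ refl → no-suspension }) , rounded-upper (t * C) A B
    where
    open Shifted M
    open Colouring (λ x y → colour (vertex x) (vertex y))
    instance
      tC≢0 : NonZero (t * C)
      tC≢0 = ℕ.m*n≢0 t C
    A = (t ∸ 2) * (t * C * r)
    B = (t ∸ 2) * ((C + t) * r)

    enough : ∀ u v → u ≢ v → rounded (t * C) A B ≤ codegree properly-coloured u v
    enough u v u≢v = rounded-lower (t * C) A B (codegree-bound (t * C) (C + t) balanced u≢v)

  module _ (t′ t D c d r n e : ℕ) where

    -- Here `2 * c` plays the part of `C` and `D` that of `t ∸ 2`. Two errors occur: about 1 / (2 c)
    -- from the imbalance of the matrix, and the rounding term 3. For `e` at least `6 * c + 1` they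
    -- fit together into 1 / c.
    clear-rounding : t ≡ suc t′ → D ≤ t → n ≡ r * t → n ≡ 3 + e → 6 * c + 1 ≤ e →
      D * (t * (2 * c) * r) ≤ t * (2 * c) * (d + 3) + D * ((2 * c + t) * r) →
      t′ * D * (suc e * c) ≤ t * t * (c * d + suc e)
    -- The summand `D * (2 * c) * n` on both sides completes `t′` to `t`, which avoids subtraction.
    clear-rounding refl D≤t n≡rt n≡3+e slack d-large = ℕ.*-cancelˡ-≤ 2 (ℕ.+-cancelʳ-≤ (D * (2 * c) * n) _ _ (begin
      2 * (t′ * D * (suc e * c)) + D * (2 * c) * n
        ≤⟨ ℕ.+-monoˡ-≤ _ (ℕ.*-monoʳ-≤ 2 (ℕ.*-monoʳ-≤ (t′ * D) (ℕ.*-monoˡ-≤ c 1+e≤n))) ⟩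
      2 * (t′ * D * (n * c)) + D * (2 * c) * n
        ≡⟨ cong (λ n → 2 * (t′ * D * (n * c)) + D * (2 * c) * n) n≡rt ⟩
      2 * (t′ * D * (r * t * c)) + D * (2 * c) * (r * t)
        ≡⟨ rearrange₁ t′ D r c ⟩
      t * (D * (t * (2 * c) * r))
        ≤⟨ ℕ.*-monoʳ-≤ t d-large ⟩
      t * (t * (2 * c) * (d + 3) + D * ((2 * c + t) * r))
        ≡⟨ rearrange₂ t c d D r ⟩
      2 * (t * t * (c * d)) + t * t * (6 * c) + D * (r * t) * t + D * (2 * c) * (r * t)
        ≡⟨ cong (λ n → 2 * (t * t * (c * d)) + t * t * (6 * c) + D * n * t + D * (2 * c) * n) n≡rt ⟨
      2 * (t * t * (c * d)) + t * t * (6 * c) + D * n * t + D * (2 * c) * n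
        ≤⟨ ℕ.+-monoˡ-≤ (D * (2 * c) * n)
             (ℕ.+-monoʳ-≤ (2 * (t * t * (c * d)) + t * t * (6 * c)) (ℕ.*-monoˡ-≤ t (ℕ.*-monoˡ-≤ n D≤t))) ⟩
      2 * (t * t * (c * d)) + t * t * (6 * c) + t * n * t + D * (2 * c) * n
        ≡⟨ cong (_+ D * (2 * c) * n) (rearrange₃ t c d n) ⟩
      2 * (t * t * (c * d)) + t * t * (6 * c + n) + D * (2 * c) * n
        ≤⟨ ℕ.+-monoˡ-≤ (D * (2 * c) * n) (ℕ.+-monoʳ-≤ (2 * (t * t * (c * d))) (ℕ.*-monoʳ-≤ (t * t) 6c+n≤2[1+e])) ⟩
      2 * (t * t * (c * d)) + t * t * (2 * suc e) + D * (2 * c) * n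
        ≡⟨ cong (_+ D * (2 * c) * n) (rearrange₄ t c d (suc e)) ⟩
      2 * (t * t * (c * d + suc e)) + D * (2 * c) * n ∎))
      where
      open ℕ.≤-Reasoning
      1+e≤n : suc e ≤ n
      1+e≤n = ℕ.≤-trans (ℕ.m≤n+m (suc e) 2) (ℕ.≤-reflexive (sym n≡3+e))
      6c+n≤2[1+e] : 6 * c + n ≤ 2 * suc e
      6c+n≤2[1+e] = begin
        6 * c + n                ≡⟨ cong (6 * c +_) n≡3+e ⟩
        6 * c + (3 + e)          ≡⟨ shift c e ⟩
        6 * c + 1 + (2 + e)      ≤⟨ ℕ.+-monoˡ-≤ (2 + e) slack ⟩
        e + (2 + e)              ≡⟨ shift′ e ⟩
        2 * suc e                ∎
        where
        shift : ∀ c e → 6 * c + (3 + e) ≡ 6 * c + 1 + (2 + e)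
        shift = solve-∀
        shift′ : ∀ e → e + (2 + e) ≡ 2 * suc e
        shift′ = solve-∀
      rearrange₁ : ∀ t′ D r c → 2 * (t′ * D * (r * suc t′ * c)) + D * (2 * c) * (r * suc t′)
                              ≡ suc t′ * (D * (suc t′ * (2 * c) * r))
      rearrange₁ = solve-∀
      rearrange₂ : ∀ t c d D r → t * (t * (2 * c) * (d + 3) + D * ((2 * c + t) * r))
        ≡ 2 * (t * t * (c * d)) + t * t * (6 * c) + D * (r * t) * t + D * (2 * c) * (r * t)
      rearrange₂ = solve-∀
      rearrange₃ : ∀ t c d n → 2 * (t * t * (c * d)) + t * t * (6 * c) + t * n * t
                             ≡ 2 * (t * t * (c * d)) + t * t * (6 * c + n)
      rearrange₃ = solve-∀
      rearrange₄ : ∀ t c d e → 2 * (t * t * (c * d)) + t * t * (2 * e) ≡ 2 * (t * t * (c * d + e))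
      rearrange₄ = solve-∀

  -- Divided by `t * t * (suc k * c)`, the inequality reads (1 - 1 / t)(1 - 2 / t) ≤ d / (n - 2) + 1
  -- / c, where n = 3 + k.
  attainable : ∀ t .{{_ : NonZero t}} c .{{_ : NonZero c}} N → ∃₂ λ k d →
    N ≤ k × Attainable ｛ suspension (complete (suc t)) ｝ (3 + k) d ×
    (t ∸ 1) * (t ∸ 2) * (suc k * c) ≤ t * t * (c * d + suc k)
  attainable t@(suc t′) c N =
    -- The 3 allows the order to be written as `3 + k`, `6 * c + 1` is the slack for
    -- `clear-rounding`, and `N` makes `k` large.
    let r , M , large , balanced = matrix t (2 * c) (3 + (6 * c + 1 + N))
        n , d , n≡rt , G , d-large = matrix-attainable (2 * c) M balanced
    in build r n d (ℕ.≤-trans large (ℕ.≤-trans (ℕ.m≤m*n r t) (ℕ.≤-reflexive (sym n≡rt)))) n≡rt G d-large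
    where
    instance
      2c≢0 : NonZero (2 * c)
      2c≢0 = ℕ.m*n≢0 2 c

    build : ∀ r n d → 3 + (6 * c + 1 + N) ≤ n → n ≡ r * t →
      Attainable ｛ suspension (complete (suc t)) ｝ n d →
      (t ∸ 2) * (t * (2 * c) * r) ≤ t * (2 * c) * (d + 3) + (t ∸ 2) * ((2 * c + t) * r) →
      ∃₂ λ k d → N ≤ k × Attainable ｛ suspension (complete (suc t)) ｝ (3 + k) d ×
        (t ∸ 1) * (t ∸ 2) * (suc k * c) ≤ t * t * (c * d + suc k)
    build r (suc (suc (suc e))) d (s≤s (s≤s (s≤s slack))) n≡rt G d-large =
      e , d , ℕ.≤-trans (ℕ.m≤n+m N (6 * c + 1)) slack , G ,
      clear-rounding t′ t (t ∸ 2) c d r (3 + e) e refl (ℕ.m∸n≤m t 2) n≡rt refl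
        (ℕ.≤-trans (ℕ.m≤m+n (6 * c + 1) N) slack) d-large

-- Passage to rationals and to the limit

open Construction using (attainable)
open import Data.Integer.Base as ℤ using (+_; +≤+; -[1+_])
import Data.Integer.Properties as ℤ
open import Data.Rational.Base as ℚ using (ℚ; 0ℚ; 1ℚ; mkℚ; _/_; _+_; _-_; _*_; -_; _≤_; _<_; toℚᵘ; *<*)
import Data.Rational.Properties as ℚ
open import Data.Rational.Unnormalised.Base as ℚᵘ using (mkℚᵘ; *≤*; _≃_)
import Data.Rational.Unnormalised.Properties as ℚᵘ

toℚᵘ-/ : ∀ i d → toℚᵘ (i / suc d) ≃ mkℚᵘ i d
toℚᵘ-/ i d = ℚ.toℚᵘ-fromℚᵘ (mkℚᵘ i d)

toℚᵘ-homo-minus : ∀ p q → toℚᵘ (p - q) ≃ toℚᵘ p ℚᵘ.- toℚᵘ q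
toℚᵘ-homo-minus p q = ℚᵘ.≃-trans (ℚ.toℚᵘ-homo-+ p (- q)) (ℚᵘ.+-congʳ (toℚᵘ p) (ℚ.toℚᵘ-homo‿- q))

toℚᵘ-factor : ∀ i d → toℚᵘ (1ℚ - i / suc d) ≃ ℚᵘ.1ℚᵘ ℚᵘ.- mkℚᵘ i d
toℚᵘ-factor i d = ℚᵘ.≃-trans (toℚᵘ-homo-minus 1ℚ (i / suc d))
  (ℚᵘ.+-congʳ ℚᵘ.1ℚᵘ (ℚᵘ.-‿cong (toℚᵘ-/ i d)))

rainbow-density : (t : ℕ) .{{_ : NonZero t}} → ℚ
rainbow-density t = (1ℚ - + 1 / t) * (1ℚ - + 2 / t)

-- With suc t for t; the truncation at t = 0 is harmless, as the first factor is 0.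
numerator : ∀ t → (ℤ.1ℤ ℤ.* + suc t ℤ.+ -[1+ 0 ] ℤ.* ℤ.1ℤ) ℤ.* (ℤ.1ℤ ℤ.* + suc t ℤ.+ -[1+ 1 ] ℤ.* ℤ.1ℤ)
  ≡ + (t ℕ.* (t ℕ.∸ 1))
numerator zero = refl
numerator (suc t) rewrite ℕ.+-identityʳ t = sym (ℤ.pos-* (suc t) t)

-- Unnormalised rationals keep explicit numerators and denominators, so cross-multiplication leaves
-- the given inequality of naturals.
rainbow-density-≤ : ∀ t .{{_ : NonZero t}} c k d →
  (t ℕ.∸ 1) ℕ.* (t ℕ.∸ 2) ℕ.* (suc k ℕ.* suc c) ℕ.≤ t ℕ.* t ℕ.* (suc c ℕ.* d ℕ.+ suc k) →
  rainbow-density t ≤ + d / suc k + + 1 / suc c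
rainbow-density-≤ t@(suc t′) c k d ineq = ℚ.toℚᵘ-cancel-≤ (begin
  toℚᵘ (rainbow-density t)
    ≃⟨ ℚ.toℚᵘ-homo-* (1ℚ - + 1 / t) (1ℚ - + 2 / t) ⟩
  toℚᵘ (1ℚ - + 1 / t) ℚᵘ.* toℚᵘ (1ℚ - + 2 / t)
    ≃⟨ ℚᵘ.*-cong (toℚᵘ-factor (+ 1) t′) (toℚᵘ-factor (+ 2) t′) ⟩
  (ℚᵘ.1ℚᵘ ℚᵘ.- mkℚᵘ (+ 1) t′) ℚᵘ.* (ℚᵘ.1ℚᵘ ℚᵘ.- mkℚᵘ (+ 2) t′)
    ≤⟨ *≤* cross ⟩
  mkℚᵘ (+ d) k ℚᵘ.+ mkℚᵘ (+ 1) c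
    ≃⟨ ℚᵘ.+-cong (toℚᵘ-/ (+ d) k) (toℚᵘ-/ (+ 1) c) ⟨
  toℚᵘ (+ d / suc k) ℚᵘ.+ toℚᵘ (+ 1 / suc c)
    ≃⟨ ℚ.toℚᵘ-homo-+ (+ d / suc k) (+ 1 / suc c) ⟨
  toℚᵘ (+ d / suc k + + 1 / suc c) ∎)
  where
  open ℚᵘ.≤-Reasoning
  den = suc k ℕ.* suc c
  cross : ℚᵘ.↥ ((ℚᵘ.1ℚᵘ ℚᵘ.- mkℚᵘ (+ 1) t′) ℚᵘ.* (ℚᵘ.1ℚᵘ ℚᵘ.- mkℚᵘ (+ 2) t′)) ℤ.* + den ℤ.≤
          (+ d ℤ.* + suc c ℤ.+ + 1 ℤ.* + suc k) ℤ.* + ((1 ℕ.* t) ℕ.* (1 ℕ.* t))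
  cross = subst₂ ℤ._≤_
    (trans (ℤ.pos-* (t′ ℕ.* (t′ ℕ.∸ 1)) den) (cong (ℤ._* + den) (sym (numerator t′))))
    (trans (ℤ.pos-* (d ℕ.* suc c ℕ.+ 1 ℕ.* suc k) _) (cong (ℤ._* + ((1 ℕ.* t) ℕ.* (1 ℕ.* t)))
      (trans (ℤ.pos-+ (d ℕ.* suc c) _) (cong₂ ℤ._+_ (ℤ.pos-* d (suc c)) (ℤ.pos-* 1 (suc k))))))
    (+≤+ (ℕ.≤-trans ineq (ℕ.≤-reflexive (rearrange t (suc c) d (suc k)))))
    where
    rearrange : ∀ t c d k → t ℕ.* t ℕ.* (c ℕ.* d ℕ.+ k) ≡ (d ℕ.* c ℕ.+ 1 ℕ.* k) ℕ.* ((1 ℕ.* t) ℕ.* (1 ℕ.* t))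
    rearrange = solve-∀

third : ∀ ε → 0ℚ < ε → ∃[ c ] 0ℚ < + 1 / suc c × + 1 / suc c + (+ 1 / suc c + + 1 / suc c) ≤ ε
third (mkℚ (+ zero)    b _) (*<* (ℤ.+<+ ()))
third (mkℚ (-[1+ _ ])  b _) (*<* ())
third ε@(mkℚ (+ suc a) b _) _ = c , positive , ℚ.toℚᵘ-cancel-≤ (begin
  toℚᵘ (δ + (δ + δ))
    ≃⟨ ℚᵘ.≃-trans (ℚ.toℚᵘ-homo-+ δ (δ + δ)) (ℚᵘ.+-congʳ (toℚᵘ δ) (ℚ.toℚᵘ-homo-+ δ δ)) ⟩
  toℚᵘ δ ℚᵘ.+ (toℚᵘ δ ℚᵘ.+ toℚᵘ δ)
    ≃⟨ ℚᵘ.+-cong (toℚᵘ-/ (+ 1) c) (ℚᵘ.+-cong (toℚᵘ-/ (+ 1) c) (toℚᵘ-/ (+ 1) c)) ⟩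
  mkℚᵘ (+ 1) c ℚᵘ.+ (mkℚᵘ (+ 1) c ℚᵘ.+ mkℚᵘ (+ 1) c)
    ≤⟨ *≤* (+≤+ cross) ⟩
  toℚᵘ ε ∎)
  where
  open ℚᵘ.≤-Reasoning
  -- Then `suc c` is 3 (b + 1), and three times its reciprocal is 1 / (b + 1), at most ε = (a + 1) /
  -- (b + 1).
  c = 2 ℕ.+ 3 ℕ.* b
  δ = + 1 / suc c
  positive : 0ℚ < δ
  positive = ℚ.positive⁻¹ δ {{ℚ.normalize-pos 1 (suc c)}}
  cross : (1 ℕ.* (suc c ℕ.* suc c) ℕ.+ (1 ℕ.* suc c ℕ.+ 1 ℕ.* suc c) ℕ.* suc c) ℕ.* suc b
        ℕ.≤ suc a ℕ.* (suc c ℕ.* (suc c ℕ.* suc c))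
  cross = ℕ.≤-trans (ℕ.≤-reflexive (rearrange b)) (ℕ.m≤n*m _ (suc a))
    where
    rearrange : ∀ b → let D = suc (2 ℕ.+ 3 ℕ.* b) in
      (1 ℕ.* (D ℕ.* D) ℕ.+ (1 ℕ.* D ℕ.+ 1 ℕ.* D) ℕ.* D) ℕ.* suc b ≡ D ℕ.* (D ℕ.* D)
    rearrange = solve-∀

corollary13 : (s : ℕ) (2≤s : 2 ℕ.≤ s) (γ : ℝ) → IsCodegreeDensity (suspension (complete s)) γ →
    let instance s∸1≢0 = >-nonZero (m<n⇒0<n∸m 2≤s) in
    fromℚ ((1ℚ - + 1 / (s ∸ 1)) * (1ℚ - + 2 / (s ∸ 1))) ≤ℝ γ
corollary13 (suc zero) (ℕ.s≤s ())
corollary13 (suc t@(suc _)) 2≤s γ (coex , isCoex , converges) ε 0<ε ¬goal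
  with third ε 0<ε
-- One `δ` is spent on the convergence to `γ`, one on the definition of `≤ℝ`, one on the error of
-- `attainable`. The goal is a double negation, so witnesses under double negations may be used.
... | c , 0<δ , 3δ≤ε = converges δ 0<δ λ (N , close) →
  -- A single order beyond `N` suffices: `γ` is close to the sequence at every index from `N` on.
  let k , d , N≤k , G , dense = attainable t (suc c) N
      d≤coex = proj₂ (isCoex (3 ℕ.+ k) (ℕ.s≤s (ℕ.s≤s ℕ.z≤n))) d G
      a = + coex (3 ℕ.+ k) / suc k
      density≤a+δ = rainbow-density-≤ t c k (coex (3 ℕ.+ k)) (ℕ.≤-trans dense
        (ℕ.*-monoʳ-≤ (t ℕ.* t) (ℕ.+-monoˡ-≤ (suc k) (ℕ.*-monoʳ-≤ (suc c) d≤coex))))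
  in proj₁ (close k N≤k) δ 0<δ λ (N′ , below) → ¬goal (N′ , λ n N′≤n → begin
    rainbow-density t                        ≤⟨ density≤a+δ ⟩
    a + δ                          ≡⟨ cong (_+ δ) (ℚ.+-identityʳ a) ⟨
    a + 0ℚ + δ                     ≡⟨ cong (λ x → a + x + δ) (ℚ.+-inverseˡ δ) ⟨
    a + (- δ + δ) + δ              ≡⟨ cong (_+ δ) (ℚ.+-assoc a (- δ) δ) ⟨
    a - δ + δ + δ                  ≤⟨ ℚ.+-monoˡ-≤ δ (ℚ.+-monoˡ-≤ δ (below n N′≤n)) ⟩
    seq γ n + δ + δ + δ            ≡⟨ trans (ℚ.+-assoc (seq γ n + δ) δ δ) (ℚ.+-assoc (seq γ n) δ (δ + δ)) ⟩
    seq γ n + (δ + (δ + δ))        ≤⟨ ℚ.+-monoʳ-≤ (seq γ n) 3δ≤ε ⟩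
    seq γ n + ε                    ∎)
  where
  open ℚ.≤-Reasoning
  δ = + 1 / suc c
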